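{- Let $p\in(0,1)$ and let $\mathcal{F},\mathcal{G}\subseteq 2^{[n]}$ be cross-Sperner families. Then $\mu_p(\mathcal{F})^{1/2}+\mu_p(\mathcal{G})^{1/2}\le 1$.
   Context: Families $\mathcal{F},\mathcal{G}\subseteq 2^{[n]}$ are cross-Sperner if for all $F\in\mathcal{F}$ and $G\in\mathcal{G}$ neither $F\subseteq G$ nor $G\subseteq F$. For $p\in(0,1)$ and $F\subseteq[n]$, $\mu_p(F)=p^{|F|}(1-p)^{n-|F|}$, and $\mu_p(\mathcal{F})=\sum_{F\in\mathcal{F}}\mu_p(F)$. -}

module Defs where

open import Algebra.Bundles using (RawSemiring)
import Algebra.Definitions.RawSemiring as RawSemiringDefinitions
open import Data.Bool using (Bool; T; if_then_else_)
open import Data.Fin.Subset using (Subset; inside; outside; _⊆_; ∣_∣)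
import Data.Integer as ℤ
import Data.Integer.Properties as ℤ
open import Data.List using (List; []; _∷_; _++_; map; foldr; filterᵇ)
open import Data.Nat as ℕ using (ℕ; zero; suc; _∸_)
import Data.Nat.Properties as ℕ
open import Data.Product using (∃-syntax; _×_; _,_; proj₁; proj₂)
open import Data.Rational as ℚ using (ℚ; 0ℚ; 1ℚ; ½)
import Data.Rational.Properties as ℚ
open import Data.Rational.Solver using (module +-*-Solver)
import Data.Rational.Unnormalised as ℚᵘ
import Data.Rational.Unnormalised.Properties as ℚᵘ
open import Data.Sum using (inj₁; inj₂)
import Data.Vec as Vec
open import Level using (0ℓ)
open import Relation.Binary.PropositionalEquality
open import Relation.Nullary using (Dec; ¬_; does; yes; no; contradiction)

module RationalLemmas where
  open import Data.Rational renaming (∣_∣ to abs)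
  open +-*-Solver

  ≤-by : ∀ {a b} d → 0ℚ ≤ d → b ≡ a + d → a ≤ b
  ≤-by {a} d 0≤d refl = subst (_≤ a + d) (ℚ.+-identityʳ a) (ℚ.+-monoʳ-≤ a 0≤d)

  0≤* : ∀ {a b} → 0ℚ ≤ a → 0ℚ ≤ b → 0ℚ ≤ a * b
  0≤* {a} {b} 0≤a 0≤b =
    subst (_≤ a * b) (ℚ.*-zeroʳ a)
      (ℚ.*-monoˡ-≤-nonNeg a {{ℚ.nonNegative 0≤a}} 0≤b)

  0<* : ∀ {a b} → 0ℚ < a → 0ℚ < b → 0ℚ < a * b
  0<* {a} {b} 0<a 0<b =
    subst (_< a * b) (ℚ.*-zeroʳ a)
      (ℚ.*-monoʳ-<-pos a {{ℚ.positive 0<a}} 0<b)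

  0≤+ : ∀ {a b} → 0ℚ ≤ a → 0ℚ ≤ b → 0ℚ ≤ a + b
  0≤+ = ℚ.+-mono-≤

  0≤1 : 0ℚ ≤ 1ℚ
  0≤1 = ℚ.<⇒≤ (ℚ.positive⁻¹ 1ℚ)

  0≤½ : 0ℚ ≤ ½
  0≤½ = ℚ.<⇒≤ (ℚ.positive⁻¹ ½)

  halve : ∀ {ε} → 0ℚ < ε → 0ℚ < ½ * ε
  halve = 0<* (ℚ.positive⁻¹ ½)

  halves : ∀ ε → ½ * ε + ½ * ε ≡ ε
  halves = solve 1 (λ e → con ½ :* e :+ con ½ :* e := e) refl

  divide : ∀ {b ε} → 0ℚ < b → 0ℚ < ε → ∃[ δ ] (0ℚ < δ × b * δ ≡ ε)
  divide {b} {ε} 0<b 0<ε = 1/b * ε , 0<* 0<1/b 0<ε , eq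
    where
    instance
      b>0 : Positive b
      b>0 = ℚ.positive 0<b
      b≢0 : NonZero b
      b≢0 = ℚ.pos⇒nonZero b
    1/b : ℚ
    1/b = 1/ b
    0<1/b : 0ℚ < 1/b
    0<1/b = ℚ.positive⁻¹ 1/b {{ℚ.1/pos⇒pos b}}
    eq : b * (1/b * ε) ≡ ε
    eq = trans (sym (ℚ.*-assoc b 1/b ε))
           (trans (cong (_* ε) (ℚ.*-inverseʳ b)) (ℚ.*-identityˡ ε))

  *-mono-≤ : ∀ {a b c d} → 0ℚ ≤ a → 0ℚ ≤ d → a ≤ b → c ≤ d → a * c ≤ b * d
  *-mono-≤ {a} {b} {c} {d} 0≤a 0≤d a≤b c≤d =
    ℚ.≤-trans (ℚ.*-monoˡ-≤-nonNeg a {{ℚ.nonNegative 0≤a}} c≤d)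
              (ℚ.*-monoʳ-≤-nonNeg d {{ℚ.nonNegative 0≤d}} a≤b)

  sq-cancel-≤ : ∀ {a b} → 0ℚ ≤ b → a * a ≤ b * b → a ≤ b
  sq-cancel-≤ {a} {b} 0≤b a²≤b² with a ≤? b
  ... | yes a≤b = a≤b
  ... | no a≰b = contradiction (ℚ.<-≤-trans b²<a² a²≤b²) (ℚ.<-irrefl refl)
    where
    b<a : b < a
    b<a = ℚ.≰⇒> a≰b
    b²<a² : b * b < a * a
    b²<a² = ℚ.≤-<-trans
      (ℚ.*-monoˡ-≤-nonNeg b {{ℚ.nonNegative 0≤b}} (ℚ.<⇒≤ b<a))
      (ℚ.*-monoˡ-<-pos a {{ℚ.positive (ℚ.≤-<-trans 0≤b b<a)}} b<a)

  abs-≤ : ∀ a → a ≤ abs a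
  abs-≤ a with ℚ.∣p∣≡p∨∣p∣≡-p a
  ... | inj₁ eq = ℚ.≤-reflexive (sym eq)
  ... | inj₂ eq = ≤-by (abs a + abs a) (0≤+ (ℚ.0≤∣p∣ a) (ℚ.0≤∣p∣ a))
                    (trans (solve 1 (λ y → y := (:- y) :+ (y :+ y)) refl (abs a))
                      (cong (_+ (abs a + abs a))
                        (trans (cong -_ eq) (solve 1 (λ y → :- (:- y) := y) refl a))))

  abs-lub : ∀ {a b} → a ≤ b → - a ≤ b → abs a ≤ b
  abs-lub {a} a≤b -a≤b with ℚ.∣p∣≡p∨∣p∣≡-p a
  ... | inj₁ eq = subst (_≤ _) (sym eq) a≤b
  ... | inj₂ eq = subst (_≤ _) (sym eq) -a≤b

  abs-lub-< : ∀ {a b} → a < b → - a < b → abs a < b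
  abs-lub-< {a} a<b -a<b with ℚ.∣p∣≡p∨∣p∣≡-p a
  ... | inj₁ eq = subst (_< _) (sym eq) a<b
  ... | inj₂ eq = subst (_< _) (sym eq) -a<b

  abs-sym : ∀ a b → abs (a - b) ≡ abs (b - a)
  abs-sym a b = trans (sym (ℚ.∣-p∣≡∣p∣ (a - b)))
    (cong abs (solve 2 (λ x y → :- (x :- y) := y :- x) refl a b))

  abs-bound : ∀ a b → abs a ≤ abs b + abs (a - b)
  abs-bound a b = subst (λ z → abs z ≤ abs b + abs (a - b))
    (solve 2 (λ x y → y :+ (x :- y) := x) refl a b)
    (ℚ.∣p+q∣≤∣p∣+∣q∣ b (a - b))

  abs-diff-< : ∀ {a b ε} → a < b + ε → b < a + ε → abs (a - b) < ε
  abs-diff-< {a} {b} {ε} a<b+ε b<a+ε = abs-lub-<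
    (subst (a - b <_) (solve 2 (λ y e → (y :+ e) :- y := e) refl b ε)
      (ℚ.+-monoˡ-< (- b) a<b+ε))
    (subst₂ _<_ (solve 2 (λ x y → y :- x := :- (x :- y)) refl a b)
      (solve 2 (λ y e → (y :+ e) :- y := e) refl a ε)
      (ℚ.+-monoˡ-< (- a) b<a+ε))

  abs-+ : ∀ {a b c d ε} → abs (a - c) < ½ * ε → abs (b - d) < ½ * ε →
          abs ((a + b) - (c + d)) < ε
  abs-+ {a} {b} {c} {d} {ε} p q = ℚ.≤-<-trans
    (subst (λ z → abs z ≤ abs (a - c) + abs (b - d))
      (solve 4 (λ a b c d → (a :- c) :+ (b :- d) := (a :+ b) :- (c :+ d)) refl a b c d)
      (ℚ.∣p+q∣≤∣p∣+∣q∣ (a - c) (b - d)))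
    (subst (abs (a - c) + abs (b - d) <_) (halves ε) (ℚ.+-mono-< p q))

  abs-* : ∀ {a b c d A D δ η ε} → 0ℚ < A → 0ℚ < D →
          A * δ ≡ ½ * ε → D * η ≡ ½ * ε →
          abs a ≤ A → abs d ≤ D →
          abs (b - d) < δ → abs (a - c) < η →
          abs (a * b - c * d) < ε
  abs-* {a} {b} {c} {d} {A} {D} {δ} {η} {ε} 0<A 0<D Aδ Dη a≤A d≤D b-d a-c =
    ℚ.≤-<-trans
      (subst (λ z → abs z ≤ abs (a * (b - d)) + abs (d * (a - c)))
        (solve 4 (λ a b c d → a :* (b :- d) :+ d :* (a :- c) := a :* b :- c :* d)
          refl a b c d)
        (ℚ.∣p+q∣≤∣p∣+∣q∣ (a * (b - d)) (d * (a - c))))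
      (subst (abs (a * (b - d)) + abs (d * (a - c)) <_) (halves ε)
        (ℚ.+-mono-< (term a (b - d) 0<A Aδ a≤A b-d) (term d (a - c) 0<D Dη d≤D a-c)))
    where
    term : ∀ u v {U ζ} → 0ℚ < U → U * ζ ≡ ½ * ε → abs u ≤ U → abs v < ζ →
           abs (u * v) < ½ * ε
    term u v {U} 0<U Uζ u≤U v<ζ = subst₂ _<_ (sym (ℚ.∣p*q∣≡∣p∣*∣q∣ u v)) Uζ
      (ℚ.≤-<-trans
        (ℚ.*-monoʳ-≤-nonNeg (abs v) {{ℚ.nonNegative (ℚ.0≤∣p∣ v)}} u≤U)
        (ℚ.*-monoʳ-<-pos U {{ℚ.positive 0<U}} v<ζ))

  ι : ℕ → ℚ
  ι zero = 0ℚ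
  ι (suc n) = 1ℚ + ι n

  0≤ι : ∀ n → 0ℚ ≤ ι n
  0≤ι zero = ℚ.≤-refl
  0≤ι (suc n) = 0≤+ 0≤1 (0≤ι n)

  ι-mono : ∀ {m n} → m ℕ.≤ n → ι m ≤ ι n
  ι-mono {n = n} ℕ.z≤n = 0≤ι n
  ι-mono (ℕ.s≤s m≤n) = ℚ.+-monoʳ-≤ 1ℚ (ι-mono m≤n)

  toℚᵘ-ι : ∀ n → toℚᵘ (ι n) ℚᵘ.≃ ℚᵘ.mkℚᵘ (ℤ.+ n) 0
  toℚᵘ-ι zero = ℚᵘ.≃-refl
  toℚᵘ-ι (suc n) =
    ℚᵘ.≃-trans (ℚ.toℚᵘ-homo-+ 1ℚ (ι n))
      (ℚᵘ.≃-trans (ℚᵘ.+-congʳ (toℚᵘ 1ℚ) (toℚᵘ-ι n))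
        (ℚᵘ.*≡* (cong (λ k → (ℤ.+ 1 ℤ.+ k) ℤ.* ℤ.+ 1) (ℤ.*-identityʳ (ℤ.+ n)))))

  archimedean : ∀ r → ∃[ N ] r ≤ ι N
  archimedean r@record{} = N , ℚ.toℚᵘ-cancel-≤
      (ℚᵘ.≤-respʳ-≃ (ℚᵘ.≃-sym (toℚᵘ-ι N)) (ℚᵘ.*≤* ineq))
    where
    N : ℕ
    N = ℤ.∣ ℚ.numerator r ∣
    i≤∣i∣ : ∀ i → i ℤ.≤ ℤ.+ ℤ.∣ i ∣
    i≤∣i∣ (ℤ.+ n) = ℤ.≤-refl
    i≤∣i∣ (ℤ.-[1+ n ]) = ℤ.-≤+
    ineq : ℚ.numerator r ℤ.* ℤ.+ 1 ℤ.≤ ℤ.+ N ℤ.* ℚ.denominator r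
    ineq = ℤ.≤-trans (ℤ.≤-reflexive (ℤ.*-identityʳ (ℚ.numerator r)))
      (ℤ.≤-trans (i≤∣i∣ (ℚ.numerator r))
        (ℤ.≤-trans (ℤ.+≤+ (ℕ.m≤m*n N (ℚ.denominatorℕ r)))
          (ℤ.≤-reflexive (ℤ.pos-* N (ℚ.denominatorℕ r)))))

Eventually : (ℕ → Set) → Set
Eventually P = ∃[ N ] ∀ n → N ℕ.≤ n → P n

-- Bisection for the square root of q ≥ 0: after n steps the root lies in
-- [ lower q n , lower q n + width q n ], starting from [ 0 , 1 + q ].
width : ℚ → ℕ → ℚ
width q zero    = 1ℚ ℚ.+ q
width q (suc n) = ½ ℚ.* width q n

lower : ℚ → ℕ → ℚ
lower q zero    = 0ℚ
lower q (suc n) =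
  let mid = lower q n ℚ.+ width q (suc n)
  in if does (mid ℚ.* mid ℚ.≤? q) then mid else lower q n

module BisectionLemmas where
  open RationalLemmas
  open import Data.Rational hiding (∣_∣)
  open +-*-Solver

  0≤width : ∀ {q} → 0ℚ ≤ q → ∀ n → 0ℚ ≤ width q n
  0≤width 0≤q zero = 0≤+ 0≤1 0≤q
  0≤width 0≤q (suc n) = 0≤* 0≤½ (0≤width 0≤q n)

  record Bracket (q l w : ℚ) : Set where
    field
      l≥0   : 0ℚ ≤ l
      l²≤q  : l * l ≤ q
      q≤u²  : q ≤ (l + w) * (l + w)
      u≤1+q : l + w ≤ 1ℚ + q

  open Bracket public

  bracket-step : ∀ {q l w} → 0ℚ ≤ w → Bracket q l w →
    let mid = l + ½ * w in (mid²≤q? : Dec (mid * mid ≤ q)) →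
    Bracket q (if does mid²≤q? then mid else l) (½ * w)
  bracket-step {q} {l} {w} 0≤w b (yes mid²≤q) = record
    { l≥0   = 0≤+ {l} {½ * w} (l≥0 b) (0≤* 0≤½ 0≤w)
    ; l²≤q  = mid²≤q
    ; q≤u²  = subst (λ z → q ≤ z * z) (sym u≡) (q≤u² b)
    ; u≤1+q = subst (_≤ 1ℚ + q) (sym u≡) (u≤1+q b)
    }
    where
    u≡ : l + ½ * w + ½ * w ≡ l + w
    u≡ = solve 2 (λ l w → l :+ con ½ :* w :+ con ½ :* w := l :+ w) refl l w
  bracket-step {q} {l} {w} 0≤w b (no mid²≰q) = record
    { l≥0   = l≥0 b
    ; l²≤q  = l²≤q b
    ; q≤u²  = ℚ.<⇒≤ (ℚ.≰⇒> mid²≰q)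
    ; u≤1+q = ℚ.≤-trans
        (≤-by (½ * w) (0≤* 0≤½ 0≤w)
          (solve 2 (λ l w → l :+ w := l :+ con ½ :* w :+ con ½ :* w) refl l w))
        (u≤1+q b)
    }

  bracket : ∀ {q} → 0ℚ ≤ q → ∀ n → Bracket q (lower q n) (width q n)
  bracket {q} 0≤q zero = record
    { l≥0   = ℚ.≤-refl
    ; l²≤q  = 0≤q
    ; q≤u²  = ≤-by (1ℚ + (q + q * q)) (0≤+ 0≤1 (0≤+ 0≤q (0≤* 0≤q 0≤q)))
        (solve 1 (λ q → (con 0ℚ :+ (con 1ℚ :+ q)) :* (con 0ℚ :+ (con 1ℚ :+ q))
                     := q :+ (con 1ℚ :+ (q :+ q :* q))) refl q)
    ; u≤1+q = ℚ.≤-reflexive (ℚ.+-identityˡ (1ℚ + q))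
    }
  bracket {q} 0≤q (suc n) =
    bracket-step {q} {lower q n} {width q n} (0≤width 0≤q n) (bracket 0≤q n)
      (mid * mid ≤? q)
    where
    mid : ℚ
    mid = lower q n + width q (suc n)

  width-decay : ∀ {q} → 0ℚ ≤ q → ∀ n → width q n * ι (suc n) ≤ 1ℚ + q
  width-decay {q} 0≤q zero = ℚ.≤-reflexive
    (solve 1 (λ q → (con 1ℚ :+ q) :* (con 1ℚ :+ con 0ℚ) := con 1ℚ :+ q) refl q)
  width-decay {q} 0≤q (suc n) = ℚ.≤-trans
    (≤-by (½ * (width q n * ι n)) (0≤* 0≤½ (0≤* (0≤width 0≤q n) (0≤ι n)))
      (solve 2 (λ w k → w :* (con 1ℚ :+ k)
          := con ½ :* w :* (con 1ℚ :+ (con 1ℚ :+ k)) :+ con ½ :* (w :* k)) refl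
        (width q n) (ι n)))
    (width-decay 0≤q n)

  width-small : ∀ B {ε} → 0ℚ < ε →
    Eventually λ n → ∀ {q} → 0ℚ ≤ q → q ≤ B → width q n < ε
  width-small B {ε} 0<ε = N , small
    where
    instance
      ε>0 : Positive ε
      ε>0 = ℚ.positive 0<ε
      ε≢0 : NonZero ε
      ε≢0 = ℚ.pos⇒nonZero ε
    r : ℚ
    r = 1/ ε * (1ℚ + B)
    N : ℕ
    N = proj₁ (archimedean r)
    εr≡ : ε * r ≡ 1ℚ + B
    εr≡ = trans (sym (ℚ.*-assoc ε (1/ ε) (1ℚ + B)))
      (trans (cong (_* (1ℚ + B)) (ℚ.*-inverseʳ ε)) (ℚ.*-identityˡ (1ℚ + B)))
    small : ∀ n → N ℕ.≤ n → ∀ {q} → 0ℚ ≤ q → q ≤ B → width q n < ε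
    small n N≤n {q} 0≤q q≤B =
      ℚ.*-cancelʳ-<-nonNeg (ι (suc n)) {{ℚ.nonNegative (0≤ι (suc n))}}
        (ℚ.≤-<-trans (width-decay 0≤q n)
          (ℚ.≤-<-trans (ℚ.+-monoʳ-≤ 1ℚ q≤B)
            (subst (_< ε * ι (suc n)) εr≡
              (ℚ.*-monoʳ-<-pos ε
                (ℚ.≤-<-trans (ℚ.≤-trans (proj₂ (archimedean r)) (ι-mono N≤n)) ι<)))))
      where
      ι< : ι n < ι (suc n)
      ι< = subst (_< 1ℚ + ι n) (ℚ.+-identityˡ (ι n))
             (ℚ.+-monoˡ-< (ι n) (ℚ.positive⁻¹ 1ℚ))

  lower-close : ∀ {a b δ ε w w′ l l′} → 0ℚ ≤ δ → 0ℚ ≤ w′ →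
    Bracket a l w → Bracket b l′ w′ →
    a ≤ b + δ * δ → w′ < ε → l < l′ + (ε + δ)
  lower-close {a} {b} {δ} {ε} {w} {w′} {l} {l′} 0≤δ 0≤w′ p q a≤b+δ² w′<ε =
    ℚ.≤-<-trans l≤
      (subst (_< l′ + (ε + δ)) (sym (ℚ.+-assoc l′ w′ δ))
        (ℚ.+-monoʳ-< l′ (ℚ.+-monoˡ-< δ w′<ε)))
    where
    0≤u : 0ℚ ≤ l′ + w′
    0≤u = 0≤+ (l≥0 q) 0≤w′
    l≤ : l ≤ l′ + w′ + δ
    l≤ = sq-cancel-≤ (0≤+ 0≤u 0≤δ)
      (ℚ.≤-trans (l²≤q p) (ℚ.≤-trans a≤b+δ²
        (ℚ.≤-trans (ℚ.+-monoˡ-≤ (δ * δ) (q≤u² q))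
          (≤-by ((l′ + w′) * δ + (l′ + w′) * δ)
            (0≤+ (0≤* 0≤u 0≤δ) (0≤* 0≤u 0≤δ))
            (solve 2 (λ u d → (u :+ d) :* (u :+ d)
               := u :* u :+ d :* d :+ (u :* d :+ u :* d)) refl (l′ + w′) δ)))))

infix 4 _≈_ _≤_ _<_
infixl 6 _+_ _-_
infixl 7 _*_

IsCauchy : (ℕ → ℚ) → Set
IsCauchy s = ∀ ε → 0ℚ ℚ.< ε →
  ∃[ N ] ∀ m n → N ℕ.≤ m → N ℕ.≤ n → ℚ.∣ s m ℚ.- s n ∣ ℚ.< ε

-- The real numbers as Cauchy sequences of rationals.  No quotient is taken:
-- equality of reals is _≈_, and _≤_ and _<_ below are invariant under it.
record ℝ : Set where
  constructor mkℝ
  field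
    seq    : ℕ → ℚ
    cauchy : IsCauchy seq

open ℝ public

_≈_ : ℝ → ℝ → Set
x ≈ y = ∀ ε → 0ℚ ℚ.< ε → Eventually λ n → ℚ.∣ seq x n ℚ.- seq y n ∣ ℚ.< ε

_≤_ : ℝ → ℝ → Set
x ≤ y = ∀ ε → 0ℚ ℚ.< ε → Eventually λ n → seq x n ℚ.≤ seq y n ℚ.+ ε

_<_ : ℝ → ℝ → Set
x < y = ∃[ ε ] (0ℚ ℚ.< ε × Eventually λ n → seq x n ℚ.+ ε ℚ.≤ seq y n)

fromℚ : ℚ → ℝ
fromℚ q = mkℝ (λ _ → q) λ ε 0<ε → 0 , λ _ _ _ _ →
  subst (λ d → ℚ.∣ d ∣ ℚ.< ε) (sym (ℚ.+-inverseʳ q)) 0<ε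

0ℝ 1ℝ : ℝ
0ℝ = fromℚ 0ℚ
1ℝ = fromℚ 1ℚ

private
  ⊔ˡ : ∀ M N {n} → M ℕ.⊔ N ℕ.≤ n → M ℕ.≤ n
  ⊔ˡ M N = ℕ.m⊔n≤o⇒m≤o M N

  ⊔ʳ : ∀ M N {n} → M ℕ.⊔ N ℕ.≤ n → N ℕ.≤ n
  ⊔ʳ M N = ℕ.m⊔n≤o⇒n≤o M N

bounded : ∀ x → ∃[ B ] (0ℚ ℚ.< B × Eventually λ n → ℚ.∣ seq x n ∣ ℚ.≤ B)
bounded x = let open RationalLemmas in
  let N , close = cauchy x 1ℚ (ℚ.positive⁻¹ 1ℚ)
      a = ℚ.∣ seq x N ∣
  in a ℚ.+ 1ℚ
   , ℚ.+-mono-≤-< (ℚ.0≤∣p∣ (seq x N)) (ℚ.positive⁻¹ 1ℚ)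
   , N , λ n N≤n → ℚ.≤-trans (abs-bound (seq x n) (seq x N))
       (ℚ.+-monoʳ-≤ a (ℚ.<⇒≤ (close n N N≤n ℕ.≤-refl)))

_+_ : ℝ → ℝ → ℝ
x + y = mkℝ (λ n → seq x n ℚ.+ seq y n) λ ε 0<ε →
  let open RationalLemmas
      M , p = cauchy x (½ ℚ.* ε) (halve 0<ε)
      N , q = cauchy y (½ ℚ.* ε) (halve 0<ε)
  in M ℕ.⊔ N , λ m n h k →
       abs-+ {a = seq x m} {b = seq y m} {c = seq x n} {d = seq y n}
         (p m n (⊔ˡ M N h) (⊔ˡ M N k)) (q m n (⊔ʳ M N h) (⊔ʳ M N k))

-_ : ℝ → ℝ
- x = mkℝ (λ n → ℚ.- seq x n) λ ε 0<ε →
  let open RationalLemmas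
      open +-*-Solver
      N , p = cauchy x ε 0<ε
  in N , λ m n h k →
       subst (λ z → ℚ.∣ z ∣ ℚ.< ε)
         (solve 2 (λ a b → b :- a := (:- a) :- (:- b)) refl (seq x m) (seq x n))
         (p n m k h)

_-_ : ℝ → ℝ → ℝ
x - y = x + (- y)

_*_ : ℝ → ℝ → ℝ
x * y = mkℝ (λ n → seq x n ℚ.* seq y n) λ ε 0<ε →
  let open RationalLemmas
      A , 0<A , M₁ , x≤A = bounded x
      D , 0<D , M₂ , y≤D = bounded y
      δ , 0<δ , Aδ = divide 0<A (halve 0<ε)
      η , 0<η , Dη = divide 0<D (halve 0<ε)
      M₃ , q = cauchy y δ 0<δ
      M₄ , p = cauchy x η 0<η
      M₁₂ = M₁ ℕ.⊔ M₂
      M₃₄ = M₃ ℕ.⊔ M₄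
  in M₁₂ ℕ.⊔ M₃₄ , λ m n h k →
       abs-* {a = seq x m} {b = seq y m} {c = seq x n} {d = seq y n} 0<A 0<D Aδ Dη
         (x≤A m (⊔ˡ M₁ M₂ (⊔ˡ M₁₂ M₃₄ h)))
         (y≤D n (⊔ʳ M₁ M₂ (⊔ˡ M₁₂ M₃₄ k)))
         (q m n (⊔ˡ M₃ M₄ (⊔ʳ M₁₂ M₃₄ h)) (⊔ˡ M₃ M₄ (⊔ʳ M₁₂ M₃₄ k)))
         (p m n (⊔ʳ M₃ M₄ (⊔ʳ M₁₂ M₃₄ h)) (⊔ʳ M₃ M₄ (⊔ʳ M₁₂ M₃₄ k)))

ℝ-rawSemiring : RawSemiring 0ℓ 0ℓ
ℝ-rawSemiring = record
  { Carrier = ℝ ; _≈_ = _≈_ ; _+_ = _+_ ; _*_ = _*_ ; 0# = 0ℝ ; 1# = 1ℝ }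

open RawSemiringDefinitions ℝ-rawSemiring public using (_^_)

-- On x < 0 this is √ (- x); the absolute value makes √ total.  That √ x is the
-- square root of every x ≥ 0 is √-nonneg and √-square.
√ : ℝ → ℝ
√ x = mkℝ (λ n → lower ℚ.∣ seq x n ∣ n) λ ε 0<ε →
  let open RationalLemmas
      open BisectionLemmas
      δ = ½ ℚ.* ε
      0<δ = halve 0<ε
      B , _ , M₁ , x≤B = bounded x
      M₂ , w< = width-small B 0<δ
      M₃ , close = cauchy x (δ ℚ.* δ) (0<* 0<δ 0<δ)
      M₁₂ = M₁ ℕ.⊔ M₂
      step : ∀ m n → M₁₂ ℕ.⊔ M₃ ℕ.≤ m → M₁₂ ℕ.⊔ M₃ ℕ.≤ n →
             lower ℚ.∣ seq x m ∣ m ℚ.< lower ℚ.∣ seq x n ∣ n ℚ.+ ε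
      step m n h k =
        subst (λ e → lower ℚ.∣ seq x m ∣ m ℚ.< lower ℚ.∣ seq x n ∣ n ℚ.+ e) (halves ε)
          (lower-close (ℚ.<⇒≤ 0<δ) (0≤width (ℚ.0≤∣p∣ (seq x n)) n)
            (bracket (ℚ.0≤∣p∣ (seq x m)) m) (bracket (ℚ.0≤∣p∣ (seq x n)) n)
            (ℚ.≤-trans (abs-bound (seq x m) (seq x n))
              (ℚ.+-monoʳ-≤ ℚ.∣ seq x n ∣ (ℚ.<⇒≤ (close m n (⊔ʳ M₁₂ M₃ h) (⊔ʳ M₁₂ M₃ k)))))
            (w< n (⊔ʳ M₁ M₂ (⊔ˡ M₁₂ M₃ k)) (ℚ.0≤∣p∣ (seq x n))
              (x≤B n (⊔ˡ M₁ M₂ (⊔ˡ M₁₂ M₃ k)))))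
  in M₁₂ ℕ.⊔ M₃ , λ m n h k → abs-diff-< (step m n h k) (step n m k h)

√-nonneg : ∀ x → 0ℝ ≤ √ x
√-nonneg x ε 0<ε = 0 , λ n _ →
  let open RationalLemmas
      open BisectionLemmas
  in 0≤+ (l≥0 (bracket (ℚ.0≤∣p∣ (seq x n)) n)) (ℚ.<⇒≤ 0<ε)

√-square : ∀ x → 0ℝ ≤ x → √ x * √ x ≈ x
√-square x 0≤x ε 0<ε =
  let B , 0<B , M₁ , x≤B = bounded x
      C = (1ℚ ℚ.+ B) ℚ.+ (1ℚ ℚ.+ B)
      0<1+B = ℚ.+-mono-<-≤ (ℚ.positive⁻¹ 1ℚ) (ℚ.<⇒≤ 0<B)
      η , 0<η , Cη = divide {b = C} (ℚ.+-mono-< 0<1+B 0<1+B) 0<ε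
      M₂ , w< = width-small B 0<η
      ζ = ½ ℚ.* (½ ℚ.* ε)
      0<ζ = halve (halve 0<ε)
      M₃ , 0≤x+ζ = 0≤x ζ 0<ζ
      M₁₂ = M₁ ℕ.⊔ M₂
  in M₁₂ ℕ.⊔ M₃ , λ n h →
    close n B η 0<B (x≤B n (⊔ˡ M₁ M₂ (⊔ˡ M₁₂ M₃ h))) Cη
      (w< n (⊔ʳ M₁ M₂ (⊔ˡ M₁₂ M₃ h)) (ℚ.0≤∣p∣ (seq x n))
        (x≤B n (⊔ˡ M₁ M₂ (⊔ˡ M₁₂ M₃ h))))
      (0≤x+ζ n (⊔ʳ M₁₂ M₃ h))
  where
  open RationalLemmas
  open BisectionLemmas
  open +-*-Solver
  close : ∀ n B η → 0ℚ ℚ.< B → ℚ.∣ seq x n ∣ ℚ.≤ B →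
    ((1ℚ ℚ.+ B) ℚ.+ (1ℚ ℚ.+ B)) ℚ.* η ≡ ε → width ℚ.∣ seq x n ∣ n ℚ.< η →
    0ℚ ℚ.≤ seq x n ℚ.+ ½ ℚ.* (½ ℚ.* ε) →
    ℚ.∣ lower ℚ.∣ seq x n ∣ n ℚ.* lower ℚ.∣ seq x n ∣ n ℚ.- seq x n ∣ ℚ.< ε
  close n B η 0<B q≤B Cη w<η 0≤a+ζ = abs-diff-< l²< a<
    where
    a q l w C ζ : ℚ
    a = seq x n
    q = ℚ.∣ a ∣
    l = lower q n
    w = width q n
    C = (1ℚ ℚ.+ B) ℚ.+ (1ℚ ℚ.+ B)
    ζ = ½ ℚ.* (½ ℚ.* ε)
    0≤q : 0ℚ ℚ.≤ q
    0≤q = ℚ.0≤∣p∣ a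
    br : Bracket q l w
    br = bracket 0≤q n
    0≤w : 0ℚ ℚ.≤ w
    0≤w = 0≤width 0≤q n
    u≤ : l ℚ.+ w ℚ.≤ 1ℚ ℚ.+ B
    u≤ = ℚ.≤-trans (u≤1+q br) (ℚ.+-monoʳ-≤ 1ℚ q≤B)
    q≤a+½ε : q ℚ.≤ a ℚ.+ ½ ℚ.* ε
    q≤a+½ε = abs-lub
      (≤-by (½ ℚ.* ε) (ℚ.<⇒≤ (halve 0<ε)) refl)
      (≤-by ((a ℚ.+ ζ) ℚ.+ (a ℚ.+ ζ)) (0≤+ 0≤a+ζ 0≤a+ζ)
        (solve 2 (λ a e → a :+ con ½ :* e
            := (:- a) :+ ((a :+ con ½ :* (con ½ :* e)) :+ (a :+ con ½ :* (con ½ :* e))))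
          refl a ε))
    ½ε<ε : ½ ℚ.* ε ℚ.< ε
    ½ε<ε = subst₂ ℚ._<_ (ℚ.+-identityʳ (½ ℚ.* ε)) (halves ε)
      (ℚ.+-monoʳ-< (½ ℚ.* ε) (halve 0<ε))
    l²< : l ℚ.* l ℚ.< a ℚ.+ ε
    l²< = ℚ.≤-<-trans (ℚ.≤-trans (l²≤q br) q≤a+½ε) (ℚ.+-monoʳ-< a ½ε<ε)
    gap : (l ℚ.+ (l ℚ.+ w)) ℚ.* w ℚ.< ε
    gap = subst ((l ℚ.+ (l ℚ.+ w)) ℚ.* w ℚ.<_) Cη
      (ℚ.≤-<-trans
        (ℚ.*-monoʳ-≤-nonNeg w {{ℚ.nonNegative 0≤w}}
          (ℚ.+-mono-≤ (ℚ.≤-trans (≤-by {l} w 0≤w refl) u≤) u≤))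
        (ℚ.*-monoʳ-<-pos C {{ℚ.positive 0<C}} w<η))
      where
      0<1+B : 0ℚ ℚ.< 1ℚ ℚ.+ B
      0<1+B = ℚ.+-mono-<-≤ (ℚ.positive⁻¹ 1ℚ) (ℚ.<⇒≤ 0<B)
      0<C : 0ℚ ℚ.< C
      0<C = ℚ.+-mono-< 0<1+B 0<1+B
    a< : a ℚ.< l ℚ.* l ℚ.+ ε
    a< = ℚ.≤-<-trans (abs-≤ a)
      (ℚ.≤-<-trans
        (ℚ.≤-trans (q≤u² br)
          (ℚ.≤-reflexive (solve 2 (λ l w → (l :+ w) :* (l :+ w)
             := l :* l :+ (l :+ (l :+ w)) :* w) refl l w)))
        (ℚ.+-monoʳ-< (l ℚ.* l) gap))

-- A family of subsets of [n], given by its characteristic function.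
Family : ℕ → Set
Family n = Subset n → Bool

infix 4 _∈ᶠ_

_∈ᶠ_ : ∀ {n} → Subset n → Family n → Set
F ∈ᶠ 𝓕 = T (𝓕 F)

CrossSperner : ∀ {n} → Family n → Family n → Set
CrossSperner 𝓕 𝓖 = ∀ F G → F ∈ᶠ 𝓕 → G ∈ᶠ 𝓖 → ¬ (F ⊆ G) × ¬ (G ⊆ F)

allSubsets : ∀ n → List (Subset n)
allSubsets zero    = Vec.[] ∷ []
allSubsets (suc n) =
  map (outside Vec.∷_) (allSubsets n) ++ map (inside Vec.∷_) (allSubsets n)

μ-set : ∀ {n} → ℝ → Subset n → ℝ
μ-set {n} p F = p ^ ∣ F ∣ * (1ℝ - p) ^ (n ∸ ∣ F ∣)

μ : ∀ {n} → ℝ → Family n → ℝ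
μ {n} p 𝓕 = foldr _+_ 0ℝ (map (μ-set p) (filterᵇ 𝓕 (allSubsets n)))

{-# OPTIONS --safe #-}
-- Let 𝓤 be the up-closure and 𝓓 the down-closure of 𝓕, and put u = μ_p(𝓤), d = μ_p(𝓓).
-- Then 𝓕 ⊆ 𝓤 ∩ 𝓓, and 𝓖 avoids 𝓤 ∪ 𝓓 because the families are cross-Sperner.  The Harris
-- inequality for the pairs (𝓤, 𝓓) and (𝓓ᶜ, 𝓤ᶜ) gives
-- μ_p(𝓕) ≤ u d ≤ ((u + d) / 2)² and μ_p(𝓖) ≤ (1 - u)(1 - d) ≤ ((2 - u - d) / 2)²,
-- and the two bounds on the square roots add up to 1.
--
-- Since the n-th approximations of μ_p and √ are rational, the argument is carried out on
-- rationals, with the n-th approximation of p as the probability.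
module Submission where

open import Defs using (ℝ; seq; Family; CrossSperner; _∈ᶠ_; allSubsets; lower; width;
  module RationalLemmas; module BisectionLemmas)
open import Data.Bool using (Bool; true; false; T)
open import Data.Fin.Subset using (Subset; inside; outside; _⊆_; ∣_∣)
open import Data.Fin.Subset.Properties using (anySubset?; _⊆?_; out⊆; s⊆s; ∣p∣≤n)
open import Data.List using (List; []; _∷_; _++_; map; foldr; filterᵇ)
open import Data.List.Properties using (map-++; map-cong; map-∘)
open import Data.Nat using (ℕ; zero; suc; _∸_)
import Data.Nat as ℕ
import Data.Nat.Properties as ℕ
open import Data.Product using (∃-syntax; _×_; _,_; proj₁; proj₂)
open import Data.Rational as ℚ using (ℚ; 0ℚ; 1ℚ)
import Data.Rational.Properties as ℚ
open import Data.Rational.Solver using (module +-*-Solver)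
open import Data.Sum using (inj₁; inj₂)
open import Data.Unit using (tt)
import Data.Vec as Vec
open import Function using (_∘_; id)
open import Relation.Binary.PropositionalEquality
open import Relation.Nullary using (Dec; ¬_; isYes; contradiction)
open import Relation.Nullary.Decidable using (T?; _×-dec_; toWitness; fromWitness)

-- Indicators and the closures of a family.

χ : Bool → ℚ
χ true  = 1ℚ
χ false = 0ℚ

module _ {n} (𝓕 : Family n) where
  above? : ∀ S → Dec (∃[ F ] (F ∈ᶠ 𝓕 × F ⊆ S))
  above? S = anySubset? λ F → T? (𝓕 F) ×-dec (F ⊆? S)

  below? : ∀ S → Dec (∃[ F ] (F ∈ᶠ 𝓕 × S ⊆ F))
  below? S = anySubset? λ F → T? (𝓕 F) ×-dec (S ⊆? F)

  -- Membership is decided by exhaustive search over the subsets of `[n]`, so each closure is again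
  -- a Boolean-valued `Family` and has an indicator `χ`.
  upClosure downClosure : Family n
  upClosure   S = isYes (above? S)
  downClosure S = isYes (below? S)

  ∈-upClosure : ∀ S → S ∈ᶠ 𝓕 → S ∈ᶠ upClosure
  ∈-upClosure S S∈𝓕 = fromWitness {a? = above? S} (S , S∈𝓕 , id)

  ∈-downClosure : ∀ S → S ∈ᶠ 𝓕 → S ∈ᶠ downClosure
  ∈-downClosure S S∈𝓕 = fromWitness {a? = below? S} (S , S∈𝓕 , id)

  upClosure-⊆ : ∀ S S′ → S ⊆ S′ → S ∈ᶠ upClosure → S′ ∈ᶠ upClosure
  upClosure-⊆ S S′ S⊆S′ S∈𝓤 with toWitness {a? = above? S} S∈𝓤
  ... | F , F∈𝓕 , F⊆S = fromWitness {a? = above? S′} (F , F∈𝓕 , S⊆S′ ∘ F⊆S)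

  downClosure-⊆ : ∀ S S′ → S ⊆ S′ → S′ ∈ᶠ downClosure → S ∈ᶠ downClosure
  downClosure-⊆ S S′ S⊆S′ S′∈𝓓 with toWitness {a? = below? S′} S′∈𝓓
  ... | F , F∈𝓕 , S′⊆F = fromWitness {a? = below? S} (F , F∈𝓕 , S′⊆F ∘ S⊆S′)

  crossSperner-∉-upClosure : ∀ {𝓖} → CrossSperner 𝓕 𝓖 → ∀ S → S ∈ᶠ 𝓖 → ¬ (S ∈ᶠ upClosure)
  crossSperner-∉-upClosure cs S S∈𝓖 S∈𝓤 with toWitness {a? = above? S} S∈𝓤
  ... | F , F∈𝓕 , F⊆S = proj₁ (cs F S F∈𝓕 S∈𝓖) F⊆S

  crossSperner-∉-downClosure : ∀ {𝓖} → CrossSperner 𝓕 𝓖 → ∀ S → S ∈ᶠ 𝓖 → ¬ (S ∈ᶠ downClosure)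
  crossSperner-∉-downClosure cs S S∈𝓖 S∈𝓓 with toWitness {a? = below? S} S∈𝓓
  ... | F , F∈𝓕 , S⊆F = proj₂ (cs F S F∈𝓕 S∈𝓖) S⊆F

module RationalBound where
  open import Data.Rational hiding (∣_∣)
  open RationalLemmas
  open BisectionLemmas
  open +-*-Solver

  -- Pointwise inequalities for indicators.

  0≤χ : ∀ a → 0ℚ ≤ χ a
  0≤χ true  = 0≤1
  0≤χ false = ℚ.≤-refl

  χ-mono : ∀ {a b} → (T a → T b) → χ a ≤ χ b
  χ-mono {false} {b}     _   = 0≤χ b
  χ-mono {true}  {true}  _   = ℚ.≤-refl
  χ-mono {true}  {false} a→b = contradiction (a→b tt) λ ()

  χ-∧ : ∀ {a b c} → (T a → T b) → (T a → T c) → χ a ≤ χ b * χ c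
  χ-∧ {false} {b}    {c}     _   _   = 0≤* (0≤χ b) (0≤χ c)
  χ-∧ {true} {true}  {true}  _   _   = ℚ.≤-refl
  χ-∧ {true} {false}         a→b _   = contradiction (a→b tt) λ ()
  χ-∧ {true} {true}  {false} _   a→c = contradiction (a→c tt) λ ()

  0≤1-χ : ∀ a → 0ℚ ≤ 1ℚ - χ a
  0≤1-χ true  = ℚ.≤-refl
  0≤1-χ false = 0≤1

  -- The right side is the indicator of the complement of a union, already in the product form that
  -- the Harris inequality bounds.
  χ-nor : ∀ {a b c} → (T a → ¬ T b) → (T a → ¬ T c) → χ a ≤ (1ℚ - χ b) * (1ℚ - χ c)
  χ-nor {false} {b}    {c}     _    _    = 0≤* (0≤1-χ b) (0≤1-χ c)
  χ-nor {true} {false} {false} _    _    = ℚ.≤-refl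
  χ-nor {true} {true}          a→¬b _    = contradiction tt (a→¬b tt)
  χ-nor {true} {false} {true}  _    a→¬c = contradiction tt (a→¬c tt)

  -- Squares and the AM-GM inequality.

  ≤⇒0≤- : ∀ {a b} → a ≤ b → 0ℚ ≤ b - a
  ≤⇒0≤- {a} {b} a≤b = subst (_≤ b - a) (ℚ.+-inverseʳ a) (ℚ.+-monoˡ-≤ (- a) a≤b)

  0≤a*a : ∀ a → 0ℚ ≤ a * a
  0≤a*a a with ℚ.≤-total 0ℚ a
  ... | inj₁ 0≤a = 0≤* 0≤a 0≤a
  ... | inj₂ a≤0 = subst (0ℚ ≤_)
    (solve 1 (λ a → (con 0ℚ :- a) :* (con 0ℚ :- a) := a :* a) refl a)
    (0≤* (≤⇒0≤- a≤0) (≤⇒0≤- a≤0))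

  -- Since `(u + d)² = 4ud + (u - d)²`, the hypothesis gives `(2l)² ≤ (u + d)²`, and the squares
  -- cancel because `u + d` is nonnegative.
  am-gm : ∀ l u d → 0ℚ ≤ u → 0ℚ ≤ d → l * l ≤ u * d → l + l ≤ u + d
  am-gm l u d 0≤u 0≤d l²≤ud = sq-cancel-≤ (0≤+ 0≤u 0≤d)
    (subst (_≤ (u + d) * (u + d))
      (solve 1 (λ l → con 4ℚ :* (l :* l) := (l :+ l) :* (l :+ l)) refl l)
      (ℚ.≤-trans (ℚ.*-monoˡ-≤-nonNeg 4ℚ l²≤ud)
        (≤-by ((u - d) * (u - d)) (0≤a*a (u - d))
          (solve 2 (λ u d → (u :+ d) :* (u :+ d) := con 4ℚ :* (u :* d) :+ (u :- d) :* (u :- d))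
            refl u d))))
    where
    4ℚ : ℚ
    4ℚ = (1ℚ + 1ℚ) + (1ℚ + 1ℚ)

  -- Finite sums and the product measure.

  sum : List ℚ → ℚ
  sum = foldr _+_ 0ℚ

  sum-++ : ∀ xs ys → sum (xs ++ ys) ≡ sum xs + sum ys
  sum-++ []       ys = sym (ℚ.+-identityˡ (sum ys))
  sum-++ (x ∷ xs) ys = trans (cong (x +_) (sum-++ xs ys)) (sym (ℚ.+-assoc x (sum xs) (sum ys)))

  sum-map-*ˡ : ∀ {A : Set} c (f : A → ℚ) xs →
               sum (map (λ x → c * f x) xs) ≡ c * sum (map f xs)
  sum-map-*ˡ c f []       = sym (ℚ.*-zeroʳ c)
  sum-map-*ˡ c f (x ∷ xs) = trans (cong (c * f x +_) (sum-map-*ˡ c f xs))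
    (sym (ℚ.*-distribˡ-+ c (f x) (sum (map f xs))))

  -- Trading the filter for a factor `χ` lets the sum run over all of `allSubsets`, where induction
  -- on `n` is available.
  sum-filterᵇ : ∀ {A : Set} (𝓕 : A → Bool) (w : A → ℚ) xs →
                sum (map w (filterᵇ 𝓕 xs)) ≡ sum (map (λ x → w x * χ (𝓕 x)) xs)
  sum-filterᵇ 𝓕 w [] = refl
  sum-filterᵇ 𝓕 w (x ∷ xs) with 𝓕 x
  ... | true  = cong₂ _+_ (sym (ℚ.*-identityʳ (w x))) (sum-filterᵇ 𝓕 w xs)
  ... | false = trans (sum-filterᵇ 𝓕 w xs)
    (trans (sym (ℚ.+-identityˡ _)) (cong (_+ _) (sym (ℚ.*-zeroʳ (w x)))))

  -- This is `q^|S| (1 - q)^(n - |S|)` with one factor per coordinate, a form suited to induction on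
  -- `n`.
  weight : ∀ {n} → ℚ → Subset n → ℚ
  weight q Vec.[]            = 1ℚ
  weight q (outside Vec.∷ S) = (1ℚ - q) * weight q S
  weight q (inside  Vec.∷ S) = q * weight q S

  -- The expectation under the product measure, computed by conditioning on the first coordinate.
  𝔼 : ∀ {n} → ℚ → (Subset n → ℚ) → ℚ
  𝔼 {zero}  q f = f Vec.[]
  𝔼 {suc n} q f = (1ℚ - q) * 𝔼 q (f ∘ (outside Vec.∷_)) + q * 𝔼 q (f ∘ (inside Vec.∷_))

  -- `allSubsets` lists the sets without the first element and then those with it; the two halves
  -- contribute the factors `1ℚ - q` and `q`.
  sum-weight : ∀ {n} q (f : Subset n → ℚ) →
               sum (map (λ S → weight q S * f S) (allSubsets n)) ≡ 𝔼 q f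
  sum-weight {zero} q f = trans (ℚ.+-identityʳ _) (ℚ.*-identityˡ (f Vec.[]))
  sum-weight {suc n} q f = begin
    sum (map g (map (outside Vec.∷_) Ss ++ map (inside Vec.∷_) Ss))
      ≡⟨ cong sum (map-++ g (map (outside Vec.∷_) Ss) (map (inside Vec.∷_) Ss)) ⟩
    sum (map g (map (outside Vec.∷_) Ss) ++ map g (map (inside Vec.∷_) Ss))
      ≡⟨ sum-++ (map g (map (outside Vec.∷_) Ss)) (map g (map (inside Vec.∷_) Ss)) ⟩
    sum (map g (map (outside Vec.∷_) Ss)) + sum (map g (map (inside Vec.∷_) Ss))
      ≡⟨ cong₂ _+_ (half outside (1ℚ - q) λ _ → refl) (half inside q λ _ → refl) ⟩
    𝔼 q f ∎
    where
    open ≡-Reasoning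
    Ss : List (Subset n)
    Ss = allSubsets n
    g : Subset (suc n) → ℚ
    g S = weight q S * f S
    half : ∀ s c → (∀ S → weight q (s Vec.∷ S) ≡ c * weight q S) →
           sum (map g (map (s Vec.∷_) Ss)) ≡ c * 𝔼 q (f ∘ (s Vec.∷_))
    half s c weight-∷ = begin
      sum (map g (map (s Vec.∷_) Ss))
        ≡⟨ cong sum (map-∘ Ss) ⟨
      sum (map (g ∘ (s Vec.∷_)) Ss)
        ≡⟨ cong sum (map-cong (λ S → trans (cong (_* f (s Vec.∷ S)) (weight-∷ S))
             (ℚ.*-assoc c (weight q S) (f (s Vec.∷ S)))) Ss) ⟩
      sum (map (λ S → c * (weight q S * f (s Vec.∷ S))) Ss)
        ≡⟨ sum-map-*ˡ c (λ S → weight q S * f (s Vec.∷ S)) Ss ⟩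
      c * sum (map (λ S → weight q S * f (s Vec.∷ S)) Ss)
        ≡⟨ cong (c *_) (sum-weight q (f ∘ (s Vec.∷_))) ⟩
      c * 𝔼 q (f ∘ (s Vec.∷_)) ∎

  𝔼-complement : ∀ {n} q (f : Subset n → ℚ) → 𝔼 q (λ S → 1ℚ - f S) ≡ 1ℚ - 𝔼 q f
  𝔼-complement {zero}  q f = refl
  𝔼-complement {suc n} q f = trans
    (cong₂ (λ a b → (1ℚ - q) * a + q * b)
      (𝔼-complement q (f ∘ (outside Vec.∷_))) (𝔼-complement q (f ∘ (inside Vec.∷_))))
    (solve 3 (λ q a b → (con 1ℚ :- q) :* (con 1ℚ :- a) :+ q :* (con 1ℚ :- b)
        := con 1ℚ :- ((con 1ℚ :- q) :* a :+ q :* b)) refl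
      q (𝔼 q (f ∘ (outside Vec.∷_))) (𝔼 q (f ∘ (inside Vec.∷_))))

  -- Monotone functions and the Harris inequality.

  Increasing Decreasing : ∀ {n} → (Subset n → ℚ) → Set
  Increasing f = ∀ S S′ → S ⊆ S′ → f S ≤ f S′
  Decreasing f = ∀ S S′ → S ⊆ S′ → f S′ ≤ f S

  complement-increasing : ∀ {n} (f : Subset n → ℚ) → Increasing f → Decreasing (λ S → 1ℚ - f S)
  complement-increasing f f↑ S S′ S⊆S′ = ℚ.+-monoʳ-≤ 1ℚ (ℚ.neg-antimono-≤ (f↑ S S′ S⊆S′))

  complement-decreasing : ∀ {n} (f : Subset n → ℚ) → Decreasing f → Increasing (λ S → 1ℚ - f S)
  complement-decreasing f f↓ S S′ S⊆S′ = ℚ.+-monoʳ-≤ 1ℚ (ℚ.neg-antimono-≤ (f↓ S S′ S⊆S′))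

  -- At r + q = 1 this is the defect in the two-point Chebyshev sum inequality.
  chebyshev-defect : ∀ r q a₀ a₁ b₀ b₁ →
    (r * a₀ + q * a₁) * (r * b₀ + q * b₁) ≡
    (r + q) * (r * (a₀ * b₀) + q * (a₁ * b₁)) + (q * r) * ((a₁ - a₀) * (b₀ - b₁))
  chebyshev-defect = solve 6 (λ r q a₀ a₁ b₀ b₁ →
    (r :* a₀ :+ q :* a₁) :* (r :* b₀ :+ q :* b₁) :=
    (r :+ q) :* (r :* (a₀ :* b₀) :+ q :* (a₁ :* b₁)) :+ (q :* r) :* ((a₁ :- a₀) :* (b₀ :- b₁)))
    refl

  module _ {q} (0≤q : 0ℚ ≤ q) (q≤1 : q ≤ 1ℚ) where
    0≤1-q : 0ℚ ≤ 1ℚ - q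
    0≤1-q = ≤⇒0≤- q≤1

    mix-mono : ∀ {a b c d} → a ≤ c → b ≤ d → (1ℚ - q) * a + q * b ≤ (1ℚ - q) * c + q * d
    mix-mono a≤c b≤d = ℚ.+-mono-≤
      (ℚ.*-monoˡ-≤-nonNeg (1ℚ - q) {{nonNegative 0≤1-q}} a≤c)
      (ℚ.*-monoˡ-≤-nonNeg q {{nonNegative 0≤q}} b≤d)

    𝔼-mono : ∀ {n} (f g : Subset n → ℚ) → (∀ S → f S ≤ g S) → 𝔼 q f ≤ 𝔼 q g
    𝔼-mono {zero}  f g f≤g = f≤g Vec.[]
    𝔼-mono {suc n} f g f≤g = mix-mono (half outside) (half inside)
      where
      half : ∀ s → 𝔼 q (f ∘ (s Vec.∷_)) ≤ 𝔼 q (g ∘ (s Vec.∷_))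
      half s = 𝔼-mono (f ∘ (s Vec.∷_)) (g ∘ (s Vec.∷_)) (f≤g ∘ (s Vec.∷_))

    0≤𝔼 : ∀ {n} (f : Subset n → ℚ) → (∀ S → 0ℚ ≤ f S) → 0ℚ ≤ 𝔼 q f
    0≤𝔼 {zero}  f 0≤f = 0≤f Vec.[]
    0≤𝔼 {suc n} f 0≤f = 0≤+ (0≤* 0≤1-q (half outside)) (0≤* 0≤q (half inside))
      where
      half : ∀ s → 0ℚ ≤ 𝔼 q (f ∘ (s Vec.∷_))
      half s = 0≤𝔼 (f ∘ (s Vec.∷_)) (0≤f ∘ (s Vec.∷_))

    -- The defect `q (1 - q) (a₁ - a₀) (b₀ - b₁)` is nonnegative because the two pairs are
    -- oppositely ordered.
    mix-chebyshev : ∀ {a₀ a₁ b₀ b₁} → a₀ ≤ a₁ → b₁ ≤ b₀ →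
      (1ℚ - q) * (a₀ * b₀) + q * (a₁ * b₁) ≤
      ((1ℚ - q) * a₀ + q * a₁) * ((1ℚ - q) * b₀ + q * b₁)
    mix-chebyshev {a₀} {a₁} {b₀} {b₁} a₀≤a₁ b₁≤b₀ =
      ≤-by ((q * (1ℚ - q)) * ((a₁ - a₀) * (b₀ - b₁)))
        (0≤* (0≤* 0≤q 0≤1-q) (0≤* (≤⇒0≤- a₀≤a₁) (≤⇒0≤- b₁≤b₀)))
        (trans (chebyshev-defect (1ℚ - q) q a₀ a₁ b₀ b₁)
          (cong (_+ (q * (1ℚ - q)) * ((a₁ - a₀) * (b₀ - b₁)))
            (trans (cong (_* m) (solve 1 (λ q → (con 1ℚ :- q) :+ q := con 1ℚ) refl q))
              (ℚ.*-identityˡ m))))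
      where
      m : ℚ
      m = (1ℚ - q) * (a₀ * b₀) + q * (a₁ * b₁)

    -- Induction on `n`: the hypothesis bounds each half, and the two-point inequality combines
    -- them. It applies because adding the first element raises the conditional expectation of `f`
    -- and lowers that of `g`.
    harris : ∀ {n} (f g : Subset n → ℚ) → Increasing f → Decreasing g →
             𝔼 q (λ S → f S * g S) ≤ 𝔼 q f * 𝔼 q g
    harris {zero}  f g f↑ g↓ = ℚ.≤-refl
    harris {suc n} f g f↑ g↓ = ℚ.≤-trans
      (mix-mono (half outside) (half inside))
      (mix-chebyshev
        (𝔼-mono (f ∘ (outside Vec.∷_)) (f ∘ (inside Vec.∷_))
          λ S → f↑ (outside Vec.∷ S) (inside Vec.∷ S) (out⊆ id))
        (𝔼-mono (g ∘ (inside Vec.∷_)) (g ∘ (outside Vec.∷_))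
          λ S → g↓ (outside Vec.∷ S) (inside Vec.∷ S) (out⊆ id)))
      where
      half : ∀ s → 𝔼 q (λ S → f (s Vec.∷ S) * g (s Vec.∷ S)) ≤
                   𝔼 q (f ∘ (s Vec.∷_)) * 𝔼 q (g ∘ (s Vec.∷_))
      half s = harris (f ∘ (s Vec.∷_)) (g ∘ (s Vec.∷_))
        (λ S S′ S⊆S′ → f↑ (s Vec.∷ S) (s Vec.∷ S′) (s⊆s S⊆S′))
        (λ S S′ S⊆S′ → g↓ (s Vec.∷ S) (s Vec.∷ S′) (s⊆s S⊆S′))

    -- Bounds for cross-Sperner families.

    𝔼-χ-upClosure 𝔼-χ-downClosure : ∀ {n} → Family n → ℚ
    𝔼-χ-upClosure   𝓕 = 𝔼 q (χ ∘ upClosure 𝓕)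
    𝔼-χ-downClosure 𝓕 = 𝔼 q (χ ∘ downClosure 𝓕)

    χ-upClosure-increasing : ∀ {n} (𝓕 : Family n) → Increasing (χ ∘ upClosure 𝓕)
    χ-upClosure-increasing 𝓕 S S′ S⊆S′ = χ-mono (upClosure-⊆ 𝓕 S S′ S⊆S′)

    χ-downClosure-decreasing : ∀ {n} (𝓕 : Family n) → Decreasing (χ ∘ downClosure 𝓕)
    χ-downClosure-decreasing 𝓕 S S′ S⊆S′ = χ-mono (downClosure-⊆ 𝓕 S S′ S⊆S′)

    𝔼-family-≤ : ∀ {n} (𝓕 : Family n) → 𝔼 q (χ ∘ 𝓕) ≤ 𝔼-χ-upClosure 𝓕 * 𝔼-χ-downClosure 𝓕
    𝔼-family-≤ 𝓕 = ℚ.≤-trans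
      (𝔼-mono (χ ∘ 𝓕) (λ S → U S * D S) λ S → χ-∧ (∈-upClosure 𝓕 S) (∈-downClosure 𝓕 S))
      (harris U D (χ-upClosure-increasing 𝓕) (χ-downClosure-decreasing 𝓕))
      where
      U D : Subset _ → ℚ
      U = χ ∘ upClosure 𝓕
      D = χ ∘ downClosure 𝓕

    𝔼-crossSperner-≤ : ∀ {n} {𝓕 𝓖 : Family n} → CrossSperner 𝓕 𝓖 →
      𝔼 q (χ ∘ 𝓖) ≤ (1ℚ - 𝔼-χ-downClosure 𝓕) * (1ℚ - 𝔼-χ-upClosure 𝓕)
    𝔼-crossSperner-≤ {𝓕 = 𝓕} {𝓖} cs = ℚ.≤-trans
      (𝔼-mono (χ ∘ 𝓖) (λ S → D̄ S * Ū S) λ S →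
        χ-nor (crossSperner-∉-downClosure 𝓕 {𝓖} cs S) (crossSperner-∉-upClosure 𝓕 {𝓖} cs S))
      (subst₂ (λ a b → 𝔼 q (λ S → D̄ S * Ū S) ≤ a * b)
        (𝔼-complement q (χ ∘ downClosure 𝓕)) (𝔼-complement q (χ ∘ upClosure 𝓕))
        -- Complementing reverses monotonicity, so the complement of the down-closure is now the
        -- increasing factor.
        (harris D̄ Ū
          (complement-decreasing (χ ∘ downClosure 𝓕) (χ-downClosure-decreasing 𝓕))
          (complement-increasing (χ ∘ upClosure 𝓕) (χ-upClosure-increasing 𝓕))))
      where
      Ū D̄ : Subset _ → ℚ
      Ū S = 1ℚ - χ (upClosure 𝓕 S)
      D̄ S = 1ℚ - χ (downClosure 𝓕 S)

    0≤𝔼-χ : ∀ {n} (𝓕 : Family n) → 0ℚ ≤ 𝔼 q (χ ∘ 𝓕)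
    0≤𝔼-χ 𝓕 = 0≤𝔼 (χ ∘ 𝓕) λ S → 0≤χ (𝓕 S)

    𝔼-χ≤1 : ∀ {n} (𝓕 : Family n) → 𝔼 q (χ ∘ 𝓕) ≤ 1ℚ
    𝔼-χ≤1 𝓕 = ≤-by (1ℚ - e)
      (subst (0ℚ ≤_) (𝔼-complement q (χ ∘ 𝓕)) (0≤𝔼 (λ S → 1ℚ - χ (𝓕 S)) λ S → 0≤1-χ (𝓕 S)))
      (solve 1 (λ e → con 1ℚ := e :+ (con 1ℚ :- e)) refl e)
      where
      e : ℚ
      e = 𝔼 q (χ ∘ 𝓕)

    crossSperner-roots : ∀ {n} {𝓕 𝓖 : Family n} → CrossSperner 𝓕 𝓖 → ∀ l m →
      l * l ≤ 𝔼 q (χ ∘ 𝓕) → m * m ≤ 𝔼 q (χ ∘ 𝓖) → l + m ≤ 1ℚ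
    crossSperner-roots {𝓕 = 𝓕} {𝓖} cs l m l²≤ m²≤ =
      -- The two AM-GM bounds on `l + l` and `m + m` add up to `2`, as `u` and `d` cancel.
      ℚ.*-cancelˡ-≤-pos (1ℚ + 1ℚ)
        (subst₂ _≤_
          (solve 2 (λ l m → (l :+ l) :+ (m :+ m) := (con 1ℚ :+ con 1ℚ) :* (l :+ m)) refl l m)
          (solve 2 (λ u d → (u :+ d) :+ ((con 1ℚ :- d) :+ (con 1ℚ :- u))
              := (con 1ℚ :+ con 1ℚ) :* con 1ℚ) refl u d)
          (ℚ.+-mono-≤
            (am-gm l u d (0≤𝔼-χ (upClosure 𝓕)) (0≤𝔼-χ (downClosure 𝓕))
              (ℚ.≤-trans l²≤ (𝔼-family-≤ 𝓕)))
            (am-gm m (1ℚ - d) (1ℚ - u)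
              (≤⇒0≤- (𝔼-χ≤1 (downClosure 𝓕))) (≤⇒0≤- (𝔼-χ≤1 (upClosure 𝓕)))
              (ℚ.≤-trans m²≤ (𝔼-crossSperner-≤ {𝓕 = 𝓕} {𝓖} cs)))))
      where
      u d : ℚ
      u = 𝔼-χ-upClosure 𝓕
      d = 𝔼-χ-downClosure 𝓕

  -- Bisection keeps its lower endpoint at or below the root, so every approximation of `√` meets
  -- the hypothesis of `crossSperner-roots` with no error term.
  lower-square : ∀ {a} → 0ℚ ≤ a → ∀ n → lower ℚ.∣ a ∣ n * lower ℚ.∣ a ∣ n ≤ a
  lower-square {a} 0≤a n = subst (lower ℚ.∣ a ∣ n * lower ℚ.∣ a ∣ n ≤_) (ℚ.0≤p⇒∣p∣≡p 0≤a)
    (l²≤q {w = width ℚ.∣ a ∣ n} (bracket (ℚ.0≤∣p∣ a) n))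

open import Defs

open RationalBound

-- Approximations of the measure as rational expectations.

seq-μ-set : ∀ {n} p (F : Subset n) k → seq (μ-set p F) k ≡ weight (seq p k) F
seq-μ-set p Vec.[] k = refl
seq-μ-set {suc n} p (inside Vec.∷ F) k =
  trans (ℚ.*-assoc (seq p k) (seq (p ^ ∣ F ∣) k) (seq ((1ℝ - p) ^ (n ∸ ∣ F ∣)) k))
    (cong (seq p k ℚ.*_) (seq-μ-set p F k))
seq-μ-set {suc n} p (outside Vec.∷ F) k = begin
  a ℚ.* seq (p̄ ^ (suc n ∸ ∣ F ∣)) k
    -- Truncated subtraction gives `suc n ∸ ∣ F ∣` as a successor only because `∣ F ∣` is at most
    -- `n`; this frees one factor `1 - p`.
    ≡⟨ cong (λ m → a ℚ.* seq (p̄ ^ m) k) (ℕ.+-∸-assoc 1 (∣p∣≤n F)) ⟩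
  a ℚ.* (seq p̄ k ℚ.* b)
    ≡⟨ solve 3 (λ a c b → a :* (c :* b) := c :* (a :* b)) refl a (seq p̄ k) b ⟩
  seq p̄ k ℚ.* (a ℚ.* b)
    ≡⟨ cong (seq p̄ k ℚ.*_) (seq-μ-set p F k) ⟩
  seq p̄ k ℚ.* weight (seq p k) F ∎
  where
  open ≡-Reasoning
  open +-*-Solver
  p̄ : ℝ
  p̄ = 1ℝ - p
  a b : ℚ
  a = seq (p ^ ∣ F ∣) k
  b = seq (p̄ ^ (n ∸ ∣ F ∣)) k

seq-sum-μ-set : ∀ {n} p (Fs : List (Subset n)) k →
  seq (foldr _+_ 0ℝ (map (μ-set p) Fs)) k ≡ sum (map (weight (seq p k)) Fs)
seq-sum-μ-set p []       k = refl
seq-sum-μ-set p (F ∷ Fs) k = cong₂ ℚ._+_ (seq-μ-set p F k) (seq-sum-μ-set p Fs k)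

seq-μ : ∀ {n} p (𝓕 : Family n) k → seq (μ p 𝓕) k ≡ 𝔼 (seq p k) (χ ∘ 𝓕)
seq-μ {n} p 𝓕 k = trans (seq-sum-μ-set p (filterᵇ 𝓕 (allSubsets n)) k)
  (trans (sum-filterᵇ 𝓕 (weight (seq p k)) (allSubsets n)) (sum-weight (seq p k) (χ ∘ 𝓕)))

theorem2p2 : ∀ (n : ℕ) (p : ℝ) → 0ℝ < p → p < 1ℝ →
    (𝓕 𝓖 : Family n) → CrossSperner 𝓕 𝓖 →
    √ (μ p 𝓕) + √ (μ p 𝓖) ≤ 1ℝ
theorem2p2 n p (δ , 0<δ , M , δ≤p) (η , 0<η , N , p+η≤1) 𝓕 𝓖 cs ε 0<ε =
  M ℕ.⊔ N , λ k M⊔N≤k →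
    -- From index `M ⊔ N` on, the gaps `δ` and `η` witnessing `0 < p < 1` place `seq p k` in the
    -- unit interval, so it can serve as a probability.
    let 0≤q = ℚ.≤-trans (RationalLemmas.0≤+ ℚ.≤-refl (ℚ.<⇒≤ 0<δ))
                (δ≤p k (ℕ.m⊔n≤o⇒m≤o M N M⊔N≤k))
        q≤1 = ℚ.≤-trans (RationalLemmas.≤-by η (ℚ.<⇒≤ 0<η) refl)
                (p+η≤1 k (ℕ.m⊔n≤o⇒n≤o M N M⊔N≤k))
        root : ∀ 𝓗 → seq (√ (μ p 𝓗)) k ℚ.* seq (√ (μ p 𝓗)) k ℚ.≤ 𝔼 (seq p k) (χ ∘ 𝓗)
        root 𝓗 = subst (λ a → lower ℚ.∣ a ∣ k ℚ.* lower ℚ.∣ a ∣ k ℚ.≤ 𝔼 (seq p k) (χ ∘ 𝓗))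
          (sym (seq-μ p 𝓗 k)) (lower-square (0≤𝔼-χ 0≤q q≤1 𝓗) k)
    -- The sum of the approximate roots is at most `1ℚ` at each such `k`; `ε` is pure slack.
    in ℚ.≤-trans (crossSperner-roots 0≤q q≤1 {𝓕 = 𝓕} {𝓖} cs
           (seq (√ (μ p 𝓕)) k) (seq (√ (μ p 𝓖)) k) (root 𝓕) (root 𝓖))
         (RationalLemmas.≤-by ε (ℚ.<⇒≤ 0<ε) refl)
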